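{- For every integer $N \ge 2$ there exists a tree $T$ with $n = N(N-1)$ vertices that has a harmonious coloring with $2N-2$ colors and that, for a certain ordering of its vertices, is colored by the greedy algorithm with $(N-1)^2+1$ colors.
   Context: All graphs are finite, simple and undirected. A harmonious coloring of a graph $G$ with $k$ colors is a proper vertex coloring $c : V(G) \to \{1,\dots,k\}$ such that for every two distinct colors $i,j$ there is at most one pair of adjacent vertices colored with $i$ and $j$. The greedy algorithm, given an ordering of the vertices, processes the vertices one by one in that order and assigns to each vertex the smallest color in $\{1,2,3,\dots\}$ that keeps the coloring constructed up to this step harmonious (that is, a harmonious coloring of the subgraph induced by the vertices colored so far). -}

module Defs where

open import Data.Nat using (ℕ; suc; _≤_; _<_)
import Data.Nat as ℕ
open import Data.Fin using (Fin; zero; suc; inject₁; fromℕ)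
import Data.Fin as Fin
open import Data.Fin.Permutation using (Permutation′; _⟨$⟩ʳ_; _⟨$⟩ˡ_)
open import Data.List using (length; deduplicate; tabulate)
open import Data.Product using (∃-syntax; _×_)
open import Data.Vec.Functional using (updateAt)
open import Function using (const)
open import Function.Definitions using (Injective)
open import Level using (0ℓ)
open import Relation.Binary using (Rel; Symmetric; Irreflexive; Decidable)
open import Relation.Binary.Construct.Closure.ReflexiveTransitive using (Star)
open import Relation.Binary.PropositionalEquality using (_≡_; _≢_)
open import Relation.Nullary using (¬_)
open import Relation.Unary using (Pred; U; _∈_)

record Graph (n : ℕ) : Set₁ where
  field
    Adj    : Rel (Fin n) 0ℓ
    adj?   : Decidable Adj
    sym    : Symmetric Adj
    irrefl : Irreflexive _≡_ Adj

open Graph public using (Adj)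

Connected : ∀ {n} → Graph n → Set
Connected G = ∀ u v → Star (Adj G) u v

-- A cycle of length suc m is an injective sequence of at least three vertices.
record Cycle {n} (G : Graph n) : Set where
  field
    m         : ℕ
    long      : 2 ≤ m
    vertex    : Fin (suc m) → Fin n
    injective : Injective _≡_ _≡_ vertex
    step      : ∀ (i : Fin m) → Adj G (vertex (inject₁ i)) (vertex (suc i))
    close     : Adj G (vertex (fromℕ m)) (vertex zero)

record IsTree {n} (G : Graph n) : Set where
  field
    nonempty  : 0 < n
    connected : Connected G
    acyclic   : ¬ Cycle G

-- The restriction of c to S is a harmonious coloring of the subgraph of G
-- induced by S; the values of c outside S are irrelevant.  As i ≢ j, an
-- unordered pair of adjacent vertices colored i and j can be listed with the
-- vertex of color i first, in exactly one way.
record HarmoniousOn {n} {C : Set} (G : Graph n) (S : Pred (Fin n) 0ℓ)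
                    (c : Fin n → C) : Set where
  field
    proper : ∀ {u v} → u ∈ S → v ∈ S → Adj G u v → c u ≢ c v
    unique : ∀ {i j} → i ≢ j →
             ∀ {u v u′ v′} → u ∈ S → v ∈ S → u′ ∈ S → v′ ∈ S →
             Adj G u v   → c u ≡ i  → c v ≡ j →
             Adj G u′ v′ → c u′ ≡ i → c v′ ≡ j →
             u ≡ u′ × v ≡ v′

Harmonious : ∀ {n} {C : Set} → Graph n → (Fin n → C) → Set
Harmonious G c = HarmoniousOn G U c

HarmoniouslyColorableWith : ∀ {n} → ℕ → Graph n → Set
HarmoniouslyColorableWith {n} k G = ∃[ c ] Harmonious {n} {Fin k} G c

-- An ordering π lists the vertices as π ⟨$⟩ʳ 0 , π ⟨$⟩ʳ 1 , …, so that
-- π ⟨$⟩ˡ v is the position of v.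
Processed : ∀ {n} → Permutation′ n → Fin n → Pred (Fin n) 0ℓ
Processed π i v = (π ⟨$⟩ˡ v) Fin.≤ i

-- Color k ∈ {1, 2, …} may be given to the i-th vertex when the vertices
-- preceding it are colored by c.  Only the values of c at those preceding
-- vertices matter.
Admissible : ∀ {n} → Graph n → Permutation′ n → (Fin n → ℕ) → Fin n → ℕ → Set
Admissible G π c i k =
  1 ≤ k × HarmoniousOn G (Processed π i) (updateAt c (π ⟨$⟩ʳ i) (const k))

-- c is the coloring produced by the greedy algorithm on the ordering π.  In
-- particular the algorithm does not get stuck: for some orderings it does,
-- since a vertex with two equally colored neighbours has no admissible color.
IsGreedyColoring : ∀ {n} → Graph n → Permutation′ n → (Fin n → ℕ) → Set
IsGreedyColoring G π c =
  ∀ i → Admissible G π c i (c (π ⟨$⟩ʳ i)) ×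
        (∀ k → Admissible G π c i k → c (π ⟨$⟩ʳ i) ≤ k)

numColors : ∀ {n} → (Fin n → ℕ) → ℕ
numColors c = length (deduplicate ℕ._≟_ (tabulate c))

{-# OPTIONS --safe #-}
module Submission where

-- With M = N − 1, take M stars with M leaves each, leaf (j , i) being the j-th
-- leaf of the i-th star, and join leaf (0 , 0) to every other leaf (i , i).
-- Coloring the i-th center by i and leaf (j , i) by M + j is harmonious.  The
-- greedy algorithm run on the centers first gives them all color 1; then every
-- leaf is adjacent to color 1, so the M² leaves get pairwise distinct colors.

open import Defs
open import Data.Nat using (ℕ; _≥_; _+_; _*_; _∸_; _^_)
open import Data.Product using (Σ-syntax; ∃-syntax; _×_)
open import Relation.Binary.PropositionalEquality using (_≡_)

open import Data.Fin using (Fin; zero; suc; toℕ; fromℕ; fromℕ<; inject₁; combine; remQuot; _↑ˡ_; _↑ʳ_)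
open import Data.Fin.Permutation using () renaming (id to idₚ)
open import Data.Fin.Properties
  using (_≟_; suc-injective; *↔×; remQuot-combine; combine-remQuot; combine-injective; combine-surjective;
         toℕ-injective; toℕ-fromℕ<; toℕ-↑ˡ; toℕ-↑ʳ; toℕ<n; ↑ˡ-injective; ↑ʳ-injective)
open import Data.Fin.Relation.Unary.Top using (view; ‵fromℕ; ‵inject₁)
open import Data.List using (deduplicate; tabulate)
open import Data.List.Membership.Propositional using (_∈_)
open import Data.List.Membership.Propositional.Properties
  using (∈-tabulate⁺; ∈-tabulate⁻; ∈-deduplicate⁺; ∈-deduplicate⁻)
open import Data.List.Membership.Propositional.Properties.WithK using (unique∧set⇒bag)
open import Data.List.Properties using (length-tabulate)
open import Data.List.Relation.Binary.BagAndSetEquality using (∼bag⇒↭)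
open import Data.List.Relation.Binary.Permutation.Propositional.Properties using (↭-length)
open import Data.List.Relation.Unary.Unique.DecPropositional.Properties using (deduplicate-!)
open import Data.List.Relation.Unary.Unique.Propositional.Properties using (tabulate⁺)
open import Data.Nat using (suc; zero; _<_; z≤n; s≤s)
import Data.Nat as ℕ
open import Data.Nat.GeneralisedArithmetic using (iterate)
import Data.Nat.Properties as ℕ
open import Data.Product using (∃₂; _,_; proj₁; proj₂; uncurry)
import Data.Product.Properties as Product
open import Data.Sum using (_⊎_; inj₁; inj₂; swap)
open import Data.Vec.Functional using (updateAt)
open import Data.Vec.Functional.Properties using (updateAt-updates; updateAt-minimal; updateAt-id-local)
open import Function using (_∘_; _∘′_; _↔_; Inverse; Injective; StrictlySurjective; mk⇔; const)
open import Level using (0ℓ)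
open import Relation.Binary using (Rel; DecidableEquality)
open import Relation.Binary.Construct.Closure.ReflexiveTransitive using (Star; ε; _◅_; _◅◅_; reverse)
open import Relation.Binary.PropositionalEquality
  using (_≢_; _≗_; refl; sym; trans; cong; subst; subst₂; ≢-sym)
open import Relation.Nullary using (¬_; yes; no; contradiction)
open import Relation.Nullary.Decidable using (¬?; _×-dec_; _⊎-dec_)
open import Relation.Unary using (Pred)

-- Counting the colors of a coloring.

numColors-∘ : ∀ {n k} {f : Fin k → ℕ} {g : Fin n → Fin k} →
              Injective _≡_ _≡_ f → StrictlySurjective _≡_ g → numColors (f ∘′ g) ≡ k
numColors-∘ {n} {k} {f} {g} f-inj g-surj =
  -- Both lists are free of duplicates and, as `g` is surjective, have the same elements, so they
  -- are permutations of each other.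
  trans (↭-length (∼bag⇒↭ (unique∧set⇒bag
          (deduplicate-! ℕ._≟_ (tabulate (f ∘′ g))) (tabulate⁺ f-inj) (mk⇔ to from))))
        (length-tabulate f)
  where
  to : ∀ {x} → x ∈ deduplicate ℕ._≟_ (tabulate (f ∘′ g)) → x ∈ tabulate f
  to x∈ with v , refl ← ∈-tabulate⁻ (∈-deduplicate⁻ ℕ._≟_ (tabulate (f ∘′ g)) x∈) = ∈-tabulate⁺ (g v)
  from : ∀ {x} → x ∈ tabulate f → x ∈ deduplicate ℕ._≟_ (tabulate (f ∘′ g))
  from x∈ with i , refl ← ∈-tabulate⁻ {f = f} x∈ with v , refl ← g-surj i =
    ∈-deduplicate⁺ ℕ._≟_ (∈-tabulate⁺ v)

-- Harmonious colorings.

module _ {n} (G : Graph n) where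

  harmonious-cong : ∀ {C : Set} {S : Pred (Fin n) 0ℓ} {c d : Fin n → C} → c ≗ d →
                    HarmoniousOn G S c → HarmoniousOn G S d
  harmonious-cong c≗d h = record
    { proper = λ u∈ v∈ uv du≡dv → proper u∈ v∈ uv (trans (c≗d _) (trans du≡dv (sym (c≗d _))))
    ; unique = λ i≢j u∈ v∈ u′∈ v′∈ uv du dv u′v′ du′ dv′ →
        unique i≢j u∈ v∈ u′∈ v′∈ uv (trans (c≗d _) du) (trans (c≗d _) dv)
                                 u′v′ (trans (c≗d _) du′) (trans (c≗d _) dv′)
    }
    where open HarmoniousOn h

  harmonious-⊆U : ∀ {C : Set} {S : Pred (Fin n) 0ℓ} {c : Fin n → C} →
                  Harmonious G c → HarmoniousOn G S c
  harmonious-⊆U h = record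
    { proper = λ _ _ → proper _ _
    ; unique = λ i≢j _ _ _ _ → unique i≢j _ _ _ _
    }
    where open HarmoniousOn h

  -- Once every edge is oriented by `E`, two edges with the same two colors either agree in
  -- direction or oppose each other, which gives the two conditions. Taking one edge twice in the
  -- second condition yields properness.
  harmonious-orientation :
    ∀ {C : Set} {c : Fin n → C} (E : Rel (Fin n) 0ℓ) →
    (∀ {u v} → Adj G u v → E u v ⊎ E v u) →
    (∀ {u v u′ v′} → E u v → E u′ v′ → c u ≡ c u′ → c v ≡ c v′ → u ≡ u′ × v ≡ v′) →
    (∀ {u v u′ v′} → E u v → E u′ v′ → c u ≡ c v′ → c v ≢ c u′) →
    Harmonious G c
  harmonious-orientation {c = c} E orient parallel antiparallel = record
    { proper = λ _ _ uv → proper (orient uv)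
    ; unique = λ { _ _ _ _ _ uv refl refl u′v′ p q → unique (orient uv) (orient u′v′) (sym p) (sym q) }
    }
    where
    proper : ∀ {u v} → E u v ⊎ E v u → c u ≢ c v
    proper (inj₁ e) eq = antiparallel e e eq (sym eq)
    proper (inj₂ e) eq = antiparallel e e (sym eq) eq

    unique : ∀ {u v u′ v′} → E u v ⊎ E v u → E u′ v′ ⊎ E v′ u′ →
             c u ≡ c u′ → c v ≡ c v′ → u ≡ u′ × v ≡ v′
    unique (inj₁ e) (inj₁ e′) p q = parallel e e′ p q
    unique (inj₁ e) (inj₂ e′) p q = contradiction q (antiparallel e e′ p)
    unique (inj₂ e) (inj₁ e′) p q = contradiction p (antiparallel e e′ q)
    unique (inj₂ e) (inj₂ e′) p q with v≡ , u≡ ← parallel e e′ q p = u≡ , v≡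

-- Neighbours along a cycle.

inject₁²≢suc² : ∀ {n} (i : Fin n) → inject₁ (inject₁ i) ≢ suc (suc i)
inject₁²≢suc² zero    ()
inject₁²≢suc² (suc i) eq = inject₁²≢suc² i (suc-injective eq)

-- The neighbours are the cyclic predecessor and successor of `i`; that they differ is where `long`
-- enters.
cycle-neighbours : ∀ {n} {G : Graph n} (C : Cycle G) → let open Cycle C in ∀ i →
  ∃₂ λ j k → j ≢ k × Adj G (vertex i) (vertex j) × Adj G (vertex i) (vertex k)
cycle-neighbours {G = G} record { m = suc (suc m) ; step = step ; close = close } zero =
  suc zero , fromℕ (suc (suc m)) , (λ ()) , step zero , Graph.sym G close
cycle-neighbours {G = G} record { m = suc (suc m) ; step = step ; close = close } (suc i) with view i
... | ‵fromℕ     = inject₁ i , zero , (λ ()) , Graph.sym G (step i) , close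
... | ‵inject₁ i = inject₁ (inject₁ i) , suc (suc i) , inject₁²≢suc² i ,
                   Graph.sym G (step (inject₁ i)) , step (suc i)
cycle-neighbours record { m = suc zero ; long = s≤s () } _

-- Rooted trees given by a parent function.

module ParentGraph {n} {V : Set} (_≟ᵥ_ : DecidableEquality V) (Fin↔V : Fin n ↔ V)
                   (parent : V → V) where

  open Inverse Fin↔V using (to; from; strictlyInverseˡ; strictlyInverseʳ)

  to-injective : Injective _≡_ _≡_ to
  to-injective {u} {v} eq = trans (sym (strictlyInverseʳ u)) (trans (cong from eq) (strictlyInverseʳ v))

  -- The inequality removes the loop at a fixed point of `parent`; the root will be one.
  Link : Rel V 0ℓ
  Link x y = x ≢ y × (parent x ≡ y ⊎ parent y ≡ x)

  graph : Graph n
  graph = record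
    { Adj    = λ u v → Link (to u) (to v)
    ; adj?   = λ u v → ¬? (to u ≟ᵥ to v) ×-dec (parent (to u) ≟ᵥ to v ⊎-dec parent (to v) ≟ᵥ to u)
    ; sym    = λ (x≢y , p) → ≢-sym x≢y , swap p
    ; irrefl = λ { refl (x≢x , _) → x≢x refl }
    }

  link⇒adj : ∀ {x y} → Link x y → Adj graph (from x) (from y)
  link⇒adj = subst₂ Link (sym (strictlyInverseˡ _)) (sym (strictlyInverseˡ _))

  path-to-ancestor : ∀ k x → Star (Adj graph) (from x) (from (iterate parent x k))
  path-to-ancestor zero    x = ε
  path-to-ancestor (suc k) x with x ≟ᵥ parent x
  ... | no x≢px = link⇒adj (x≢px , inj₁ refl) ◅ path-to-ancestor k (parent x)
  ... | yes x≡px = subst (λ y → Star (Adj graph) (from y) (from (iterate parent (parent x) k)))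
                     (sym x≡px) (path-to-ancestor k (parent x))

  -- Of two distinct neighbours at most one is the parent, so a cycle could be
  -- followed from child to child for ever.
  cycle-child : (C : Cycle graph) → let open Cycle C in ∀ i → ∃[ j ] parent (to (vertex j)) ≡ to (vertex i)
  cycle-child C i with cycle-neighbours C i
  ... | j , k , j≢k , (_ , inj₂ j↑i) , _            = j , j↑i
  ... | j , k , j≢k , _ , (_ , inj₂ k↑i)            = k , k↑i
  ... | j , k , j≢k , (_ , inj₁ i↑j) , (_ , inj₁ i↑k) =
    contradiction (Cycle.injective C (to-injective (trans (sym i↑j) i↑k))) j≢k

  cycle-descendant : (C : Cycle graph) → let open Cycle C in ∀ k i →
                     ∃[ j ] iterate parent (to (vertex j)) k ≡ to (vertex i)
  cycle-descendant C zero    i = i , refl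
  cycle-descendant C (suc k) i
    with j , eq ← cycle-descendant C k i
    with l , l↑j ← cycle-child C j = l , trans (cong (λ x → iterate parent x k) l↑j) eq

  -- Climbing `height` times joins every vertex to the root. On a cycle, each vertex has a
  -- descendant on the cycle `height` generations below it, hence is itself the root, against
  -- injectivity.
  isTree : ∀ {root} height → (∀ x → iterate parent x height ≡ root) → IsTree graph
  isTree {root} height rooted = record
    { nonempty  = ℕ.≤-<-trans z≤n (toℕ<n (from root))
    ; connected = λ u v → path u ◅◅ reverse (Graph.sym graph) (path v)
    ; acyclic   = acyclic
    }
    where
    path : ∀ u → Star (Adj graph) u (from root)
    path u = subst₂ (λ v x → Star (Adj graph) v (from x)) (strictlyInverseʳ u) (rooted (to u))
               (path-to-ancestor height (to u))

    acyclic : ¬ Cycle graph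
    acyclic C@record { m = suc _ } = contradiction (Cycle.injective C (to-injective same-vertex)) λ ()
      where
      at-root : ∀ i → to (Cycle.vertex C i) ≡ root
      at-root i with j , eq ← cycle-descendant C height i = trans (sym eq) (rooted _)

      same-vertex : to (Cycle.vertex C zero) ≡ to (Cycle.vertex C (suc zero))
      same-vertex = trans (at-root zero) (sym (at-root (suc zero)))
    acyclic record { m = zero ; long = () }

-- The tree of `M` stars.

module StarTree (m : ℕ) where

  M : ℕ
  M = suc m

  -- The codes are lexicographic, so all centers precede all leaves and the identity serves as the
  -- greedy ordering.
  Vertex : Set
  Vertex = Fin (suc M) × Fin M

  pattern center i = zero , i
  pattern leaf j i = suc j , i

  root : Vertex
  root = leaf zero zero

  -- Each star is reached from the root through its diagonal leaf, so the center hangs below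
  -- `leaf i i` and the other leaves below the center. A climb takes at most three steps: leaf,
  -- center, diagonal leaf, root.
  parent : Vertex → Vertex
  parent (center i) = leaf i i
  parent (leaf j i) with j ≟ i
  ... | yes _ = root
  ... | no  _ = center i

  parent-diagonal : ∀ i → parent (leaf i i) ≡ root
  parent-diagonal i with i ≟ i
  ... | yes _  = refl
  ... | no i≢i = contradiction refl i≢i

  rooted : ∀ x → iterate parent x 3 ≡ root
  rooted (center i) = cong parent (parent-diagonal i)
  rooted (leaf j i) with j ≟ i
  ... | yes _ = refl
  ... | no  _ = parent-diagonal i

  open ParentGraph (Product.≡-dec _≟_ _≟_) (*↔× {suc M} {M}) parent
    using (Link; link⇒adj; to-injective; isTree) renaming (graph to tree) public

  code : Vertex → Fin (suc M * M)
  code = uncurry combine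

  coords : Fin (suc M * M) → Vertex
  coords = remQuot M

  -- Edges are oriented by kind, not by depth: `spoke i i` points from child to parent, all others
  -- from parent to child. Every edge thus ends in a leaf, and its source tells the two kinds apart.
  data Edge : Rel Vertex 0ℓ where
    spoke  : ∀ i j → Edge (center i) (leaf j i)
    bridge : ∀ {i} → i ≢ zero → Edge root (leaf i i)

  parent-edge : ∀ x → x ≢ parent x → Edge x (parent x) ⊎ Edge (parent x) x
  parent-edge (center i) _ = inj₁ (spoke i i)
  parent-edge (leaf j i) x≢px with j ≟ i
  -- For index zero the leaf would be the root, which is its own parent.
  ... | yes refl = inj₂ (bridge λ { refl → x≢px refl })
  ... | no _     = inj₂ (spoke i j)

  link⇒edge : ∀ {x y} → Link x y → Edge x y ⊎ Edge y x
  link⇒edge (x≢y , inj₁ refl) = parent-edge _ x≢y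
  link⇒edge (x≢y , inj₂ refl) = swap (parent-edge _ (≢-sym x≢y))

  spoke-adj : ∀ i j → Adj tree (code (center i)) (code (leaf j i))
  spoke-adj i j = link⇒adj ((λ ()) , lemma)
    where
    lemma : leaf i i ≡ leaf j i ⊎ parent (leaf j i) ≡ center i
    lemma with j ≟ i
    ... | yes refl = inj₁ refl
    ... | no _     = inj₂ refl

  harmonious : ∀ {C : Set} {f : Vertex → C} →
    (∀ {x y x′ y′} → Edge x y → Edge x′ y′ → f x ≡ f x′ → f y ≡ f y′ → x ≡ x′ × y ≡ y′) →
    (∀ {x y x′ y′} → Edge x y → Edge x′ y′ → f x ≡ f y′ → f y ≢ f x′) →
    Harmonious tree (f ∘′ coords)
  harmonious parallel antiparallel =
    harmonious-orientation tree (λ u v → Edge (coords u) (coords v)) link⇒edge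
      (λ e e′ p q → let x≡ , y≡ = parallel e e′ p q in to-injective x≡ , to-injective y≡)
      antiparallel

  -- The coloring with `M + M` colors.

  ↑ˡ≢↑ʳ : ∀ {k l} (i : Fin k) (j : Fin l) → i ↑ˡ l ≢ k ↑ʳ j
  ↑ˡ≢↑ʳ (suc i) j eq = ↑ˡ≢↑ʳ i j (suc-injective eq)

  economical : Vertex → Fin (M + M)
  economical (center i) = i ↑ˡ M
  economical (leaf j _) = M ↑ʳ j

  -- Centers and leaves use disjoint halves of the colors. A spoke shows `i` at its source and `j`
  -- at its target; a bridge is known from its target. Two opposed bridges would need a target with
  -- the color of the root, hence index zero.
  economical-harmonious : Harmonious tree (economical ∘′ coords)
  economical-harmonious = harmonious parallel antiparallel
    where
    parallel : ∀ {x y x′ y′} → Edge x y → Edge x′ y′ →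
               economical x ≡ economical x′ → economical y ≡ economical y′ → x ≡ x′ × y ≡ y′
    parallel (spoke i j) (spoke i′ j′) p q
      with refl ← ↑ˡ-injective M i i′ p | refl ← ↑ʳ-injective M j j′ q = refl , refl
    parallel (spoke i j) (bridge _)    p q = contradiction p (↑ˡ≢↑ʳ i zero)
    parallel (bridge _)  (spoke i j)   p q = contradiction (sym p) (↑ˡ≢↑ʳ i zero)
    parallel (bridge _)  (bridge _)    p q with refl ← ↑ʳ-injective M _ _ q = refl , refl

    antiparallel : ∀ {x y x′ y′} → Edge x y → Edge x′ y′ →
                   economical x ≡ economical y′ → economical y ≢ economical x′
    antiparallel (spoke i _) (spoke _ j)  p q = ↑ˡ≢↑ʳ i j p
    antiparallel (spoke i _) (bridge {j} _) p q = ↑ˡ≢↑ʳ i j p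
    antiparallel (bridge {j} _) (spoke i _) p q = ↑ˡ≢↑ʳ i j (sym q)
    antiparallel (bridge j≢0) (bridge _)  p q = j≢0 (↑ʳ-injective M _ _ q)

  -- The greedy coloring.

  rank : Vertex → Fin (suc (M * M))
  rank (center _) = zero
  rank (leaf j i) = suc (combine j i)

  -- The successor makes colors start at 1; factoring through `rank` lets `numColors-∘` count them.
  greedy : Vertex → ℕ
  greedy = suc ∘′ toℕ ∘′ rank

  greedy-leaf-injective : ∀ j i j′ i′ → greedy (leaf j i) ≡ greedy (leaf j′ i′) → j ≡ j′ × i ≡ i′
  greedy-leaf-injective j i j′ i′ =
    combine-injective j i j′ i′ ∘′ toℕ-injective ∘′ ℕ.suc-injective ∘′ ℕ.suc-injective

  -- Leaf colors are pairwise distinct and every edge ends in a leaf, so the target determines an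
  -- edge among those of its kind. Color 1 at the source separates spokes from bridges and occurs at
  -- no target.
  greedy-harmonious : Harmonious tree (greedy ∘′ coords)
  greedy-harmonious = harmonious parallel antiparallel
    where
    parallel : ∀ {x y x′ y′} → Edge x y → Edge x′ y′ →
               greedy x ≡ greedy x′ → greedy y ≡ greedy y′ → x ≡ x′ × y ≡ y′
    parallel (spoke i j) (spoke i′ j′) p q with refl , refl ← greedy-leaf-injective j i j′ i′ q = refl , refl
    parallel (spoke _ _) (bridge _)  () q
    parallel (bridge _)  (spoke _ _) () q
    parallel (bridge {i} _) (bridge {i′} _) p q with refl , refl ← greedy-leaf-injective i i i′ i′ q = refl , refl

    antiparallel : ∀ {x y x′ y′} → Edge x y → Edge x′ y′ → greedy x ≡ greedy y′ → greedy y ≢ greedy x′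
    antiparallel (spoke _ _)  (spoke _ _) () q
    antiparallel (spoke _ _)  (bridge _)  () q
    antiparallel (bridge _)   (spoke _ _) p ()
    antiparallel (bridge {i} i≢0) (bridge _) p q = i≢0 (proj₁ (greedy-leaf-injective i i zero zero q))

  coloring : Fin (suc M * M) → ℕ
  coloring = greedy ∘′ coords

  coloring-code : ∀ x → coloring (code x) ≡ greedy x
  coloring-code (j , i) = cong greedy (remQuot-combine j i)

  -- Under the identity ordering codes are positions: the centers occupy the first `M` places.
  center<leaf : ∀ i j i′ → toℕ (code (center i)) < toℕ (code (leaf j i′))
  center<leaf i j i′ = begin-strict
    toℕ (i ↑ˡ M * M)          ≡⟨ toℕ-↑ˡ i (M * M) ⟩
    toℕ i                     <⟨ toℕ<n i ⟩
    M                         ≤⟨ ℕ.m≤m+n M _ ⟩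
    M + toℕ (combine j i′)    ≡⟨ toℕ-↑ʳ M (combine j i′) ⟨
    toℕ (M ↑ʳ combine j i′)   ∎
    where open ℕ.≤-Reasoning

  recolored-earlier : ∀ {v} x k → toℕ (code x) < toℕ v → updateAt coloring v (const k) (code x) ≡ greedy x
  recolored-earlier {v} x k x<v =
    trans (updateAt-minimal (code x) v coloring λ { refl → ℕ.<-irrefl refl x<v }) (coloring-code x)

  admissible : ∀ v → Admissible tree idₚ coloring v (coloring v)
  admissible v = s≤s z≤n ,
    -- Recoloring `v` with its own color changes nothing, and a harmonious coloring of the whole
    -- tree stays harmonious on the processed vertices.
    harmonious-cong tree (sym ∘ updateAt-id-local v coloring refl) (harmonious-⊆U tree greedy-harmonious)

  -- A leaf cannot reuse the color of an earlier leaf: both are adjacent to a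
  -- center, and all centers have color 1.
  least : ∀ x k → Admissible tree idₚ coloring (code x) k → ¬ (k < greedy x)
  least (center i) _ (s≤s _ , _) (s≤s ())
  -- Color 1 fails by properness: the center of this leaf already has it.
  least (leaf j i) 1 (_ , h) _ =
    HarmoniousOn.proper h (ℕ.<⇒≤ (center<leaf i j i)) ℕ.≤-refl (spoke-adj i j)
      (trans (recolored-earlier (center i) 1 (center<leaf i j i))
             (sym (updateAt-updates (code (leaf j i)) coloring)))
  least (leaf j i) (suc (suc k)) (_ , h) (s≤s (s≤s k<w))
    -- Leaf colors are 2 plus the `combine` index, so a color `2 + k` below this leaf's own belongs
    -- to the leaf with index `k`.
    with j′ , i′ , eq ← combine-surjective {M} {M} (fromℕ< (ℕ.<-trans k<w (toℕ<n (combine j i)))) =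
    ℕ.<-irrefl (cong toℕ (sym (proj₂ same))) earlier
    where
    w  = code (leaf j i)
    w′ = code (leaf j′ i′)

    k≡ : toℕ (combine j′ i′) ≡ k
    k≡ = trans (cong toℕ eq) (toℕ-fromℕ< _)

    earlier : toℕ w′ < toℕ w
    earlier = subst₂ _<_ (sym (toℕ-↑ʳ M (combine j′ i′))) (sym (toℕ-↑ʳ M (combine j i)))
                (ℕ.+-monoʳ-< M (subst (_< toℕ (combine j i)) (sym k≡) k<w))

    same : code (center i) ≡ code (center i′) × w ≡ w′
    -- Both spokes carry the colors 1 and `2 + k`.
    same = HarmoniousOn.unique h {i = 1} {j = suc (suc k)} (λ ())
      (ℕ.<⇒≤ (center<leaf i j i)) ℕ.≤-refl (ℕ.<⇒≤ (center<leaf i′ j i)) (ℕ.<⇒≤ earlier)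
      (spoke-adj i j)
      (recolored-earlier (center i) _ (center<leaf i j i)) (updateAt-updates w coloring)
      (spoke-adj i′ j′)
      (recolored-earlier (center i′) _ (center<leaf i′ j i))
      (trans (recolored-earlier (leaf j′ i′) _ earlier) (cong (suc ∘′ suc) k≡))

  isGreedy : IsGreedyColoring tree idₚ coloring
  isGreedy v = admissible v , λ k adm →
    ℕ.≮⇒≥ (least (coords v) k
      (subst (λ u → Admissible tree idₚ coloring u k) (sym (combine-remQuot M v)) adm))

  rank-surjective : StrictlySurjective _≡_ (rank ∘′ coords)
  rank-surjective zero    = code (center zero) , cong rank (remQuot-combine {suc M} zero zero)
  rank-surjective (suc w) with j , i , eq ← combine-surjective {M} {M} w =
    code (leaf j i) , trans (cong rank (remQuot-combine {suc M} (suc j) i)) (cong suc eq)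

  numColors-coloring : numColors coloring ≡ suc (M * M)
  numColors-coloring = numColors-∘ {f = suc ∘′ toℕ} (toℕ-injective ∘′ ℕ.suc-injective) rank-surjective

theorem12 : ∀ (N : ℕ) → N ≥ 2 →
    Σ[ T ∈ Graph (N * (N ∸ 1)) ]
    ( IsTree T
    × HarmoniouslyColorableWith (2 * N ∸ 2) T
    × ∃[ π ] ∃[ c ] (IsGreedyColoring T π c × numColors c ≡ (N ∸ 1) ^ 2 + 1))
theorem12 (suc (suc m)) (s≤s (s≤s z≤n)) =
  tree , isTree 3 rooted ,
  subst (λ k → HarmoniouslyColorableWith k tree) M+M≡ (_ , economical-harmonious) ,
  idₚ , coloring , isGreedy , trans numColors-coloring M²+1≡
  where
  open StarTree m

  M+M≡ : M + M ≡ 2 * suc M ∸ 2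
  -- Here `2 * suc M ∸ 2` computes to `m + suc (suc (m + 0))`.
  M+M≡ = trans (cong (M +_) (sym (ℕ.+-identityʳ M))) (sym (ℕ.+-suc m (suc (m + 0))))

  M²+1≡ : suc (M * M) ≡ M ^ 2 + 1
  M²+1≡ = trans (ℕ.+-comm 1 (M * M)) (cong (λ k → M * k + 1) (sym (ℕ.*-identityʳ M)))
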